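{- For every integer $n\ge 1$, the quintuple of statistics $(\mathrm{rlm},\mathrm{rlmin},\mathrm{w\overline{m}},\mathrm{des},\mathrm{ides})$ is equally distributed with the quintuple $(\mathrm{rlm},\mathrm{w\overline{m}},\mathrm{rlmin},\mathrm{des},\mathrm{ides})$ over $S_n(321)$, the set of $321$-avoiding permutations of $[n]$.
   Context: $S_n$ is the set of permutations $\pi=\pi_1\pi_2\cdots\pi_n$ of $[n]=\{1,\dots,n\}$. $S_n(321)$ is the set of $\pi\in S_n$ for which there are no indices $i<j<k$ with $\pi_i>\pi_j>\pi_k$. Statistics. For a word $w=w_1\cdots w_m$ of distinct integers, $w_i$ is an RL-maximum if $w_i>w_j$ for all $j>i$, and an RL-minimum if $w_i<w_j$ for all $j>i$; $\mathrm{rlmin}(w)$ is the number of RL-minima of $w$. For $\pi\in S_n$, $\mathrm{rlm}(\pi)$ is the number of RL-maxima of the (possibly empty) subword of $\pi$ consisting of the letters to the left of the letter $1$. An index $i$ is a weak excedance of $\pi$ if $\pi_i\ge i$; it is a mid-point of $\pi$ if there exist $j<i<k$ with $\pi_j>\pi_i>\pi_k$, and a non-mid-point otherwise. $\mathrm{w\overline{m}}(\pi)$ is the number of indices $i$ that are both a weak excedance and a non-mid-point of $\pi$. $\mathrm{des}(\pi)$ is the number of $i\in[n-1]$ with $\pi_i>\pi_{i+1}$, and $\mathrm{ides}(\pi)=\mathrm{des}(\pi^{ -1})$. Two tuples of statistics $(f_1,\dots,f_k)$ and $(g_1,\dots,g_k)$ are equally distributed over a finite set $X$ if for every tuple of values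 $(a_1,\dots,a_k)$ the number of $x\in X$ with $(f_1(x),\dots,f_k(x))=(a_1,\dots,a_k)$ equals the number of $x\in X$ with $(g_1(x),\dots,g_k(x))=(a_1,\dots,a_k)$. -}

module Defs where

open import Data.Nat.Base as ℕ using (ℕ; zero; suc)
import Data.Nat.Properties as ℕ
open import Data.Fin.Base using (Fin; suc; inject₁; toℕ; _≤_; _<_; _>_)
open import Data.Fin.Properties using (_≤?_; _<?_; any?; all?)
open import Data.Fin.Permutation using (Permutation′; _⟨$⟩ʳ_; flip)
open import Data.List.Base as List using (List; length; lookup; takeWhile)
open import Data.Product.Base using (Σ-syntax; ∃-syntax; _×_; _,_; proj₁)
open import Data.Vec.Base using (count; allFin)
open import Function.Base using (_∘_)
open import Function.Bundles using (Inverse)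
open import Level using (Level; 0ℓ)
open import Relation.Binary.Bundles using (Setoid)
import Relation.Binary.Construct.On as On
open import Relation.Binary.PropositionalEquality using (_≡_; setoid; _→-setoid_)
open import Relation.Nullary.Decidable using (¬?; _×-dec_; _→-dec_)
open import Relation.Nullary.Negation using (¬_)
open import Relation.Unary using (Decidable)

private
  variable
    a ℓ : Level
    n : ℕ

-- A permutation of [n] is a bijection of Fin n, so both positions and values
-- are shifted down by one; every notion below that is stated on Fin depends
-- only on the relative order of positions and values.

----------------------------------------------------------------------
-- Words of natural numbers

IsRLMax : (w : List ℕ) → Fin (length w) → Set
IsRLMax w i = ∀ j → i < j → lookup w j ℕ.< lookup w i

IsRLMin : (w : List ℕ) → Fin (length w) → Set
IsRLMin w i = ∀ j → i < j → lookup w i ℕ.< lookup w j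

isRLMax? : ∀ w → Decidable (IsRLMax w)
isRLMax? w i = all? λ j → i <? j →-dec lookup w j ℕ.<? lookup w i

isRLMin? : ∀ w → Decidable (IsRLMin w)
isRLMin? w i = all? λ j → i <? j →-dec lookup w i ℕ.<? lookup w j

#RLMax : List ℕ → ℕ
#RLMax w = count (isRLMax? w) (allFin (length w))

#RLMin : List ℕ → ℕ
#RLMin w = count (isRLMin? w) (allFin (length w))

----------------------------------------------------------------------
-- Permutation statistics

-- One-line notation π₁π₂⋯πₙ, with the letters shifted back to 1, …, n.
word : Permutation′ n → List ℕ
word π = List.tabulate (λ i → suc (toℕ (π ⟨$⟩ʳ i)))

rlm : Permutation′ n → ℕ
rlm π = #RLMax (takeWhile (λ x → ¬? (x ℕ.≟ 1)) (word π))

rlmin : Permutation′ n → ℕ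
rlmin π = #RLMin (word π)

WeakExcedance : Permutation′ n → Fin n → Set
WeakExcedance π i = i ≤ π ⟨$⟩ʳ i

MidPoint : Permutation′ n → Fin n → Set
MidPoint π i =
  (∃[ j ] j < i × π ⟨$⟩ʳ j > π ⟨$⟩ʳ i) ×
  (∃[ k ] i < k × π ⟨$⟩ʳ i > π ⟨$⟩ʳ k)

weakExcedance? : (π : Permutation′ n) → Decidable (WeakExcedance π)
weakExcedance? π i = i ≤? π ⟨$⟩ʳ i

midPoint? : (π : Permutation′ n) → Decidable (MidPoint π)
midPoint? π i =
  any? (λ j → j <? i ×-dec (π ⟨$⟩ʳ i) <? (π ⟨$⟩ʳ j)) ×-dec
  any? (λ k → i <? k ×-dec (π ⟨$⟩ʳ k) <? (π ⟨$⟩ʳ i))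

wm̄ : Permutation′ n → ℕ
wm̄ {n} π = count (λ i → weakExcedance? π i ×-dec ¬? (midPoint? π i)) (allFin n)

-- For i : Fin n, inject₁ i and suc i are consecutive positions in Fin (suc n).
des : Permutation′ n → ℕ
des {zero}  π = 0
des {suc n} π = count (λ i → (π ⟨$⟩ʳ suc i) <? (π ⟨$⟩ʳ inject₁ i)) (allFin n)

ides : Permutation′ n → ℕ
ides π = des (flip π)

----------------------------------------------------------------------
-- 321-avoiding permutations

Avoids321 : Permutation′ n → Set
Avoids321 π = ¬ (∃[ i ] ∃[ j ] ∃[ k ]
  i < j × j < k × π ⟨$⟩ʳ i > π ⟨$⟩ʳ j × π ⟨$⟩ʳ j > π ⟨$⟩ʳ k)

-- Sₙ(321). Equality is pointwise equality of the underlying functions, so the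
-- proofs carried by an element (bijectivity, avoidance) are not counted.
S₃₂₁ : ℕ → Setoid 0ℓ 0ℓ
S₃₂₁ n = On.setoid {B = Σ[ π ∈ Permutation′ n ] Avoids321 π}
                   (Fin n →-setoid Fin n) (λ (π , _) → π ⟨$⟩ʳ_)

----------------------------------------------------------------------
-- Equidistribution

HasCardinality : Setoid a ℓ → ℕ → Set _
HasCardinality X N = Inverse X (setoid (Fin N))

-- { x ∈ X ∣ f x ≡ v }, for f compatible with the equality of X.
Fibre : (X : Setoid a ℓ) {V : Set} → (Setoid.Carrier X → V) → V → Setoid a ℓ
Fibre X f v = On.setoid {B = Σ[ x ∈ Setoid.Carrier X ] f x ≡ v} X proj₁

EquallyDistributed : (X : Setoid a ℓ) {V : Set} → (f g : Setoid.Carrier X → V) → Set _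
EquallyDistributed X f g = ∀ v → ∃[ N ]
  HasCardinality (Fibre X f v) N × HasCardinality (Fibre X g v) N

{-# OPTIONS --safe #-}
module Submission where

-- The letters that are weak excedances and non-mid-points are exactly the
-- left-to-right maxima, so reverse-complement preserves des and ides and exchanges
-- rlmin with wm̄, but it does not respect rlm. In a 321-avoiding permutation the
-- letters before 1 increase, so rlm is 0 if π₁ = 1 and 1 otherwise. Those with
-- π₁ = 1 are the 1 ⊕ σ with σ in Sₙ₋₁(321), whose statistics are those of σ up to
-- a common shift of rlmin and wm̄; reverse-complementing σ gives the claim for
-- rlm = 0. Subtracting from the count over all of Sₙ(321) gives it for rlm = 1.

open import Defs
open import Data.Bool.Base using (true; false)
open import Data.Fin.Base as Fin using (Fin; zero; suc; inject₁; fromℕ; fromℕ<; cast; opposite; toℕ; finToFun; funToFin)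
import Data.Fin.Properties as Fin
open import Data.Fin.Permutation as Perm using (Permutation; Permutation′; permutation; _⟨$⟩ʳ_; _⟨$⟩ˡ_; flip; _∘ₚ_; lift₀; remove)
open import Data.List.Base as List using (List; []; _∷_; length)
import Data.List.Properties as List
open import Data.List.Membership.Propositional.Properties using (∈-lookup)
open import Data.List.Relation.Unary.All as All using (All; []; _∷_)
open import Data.List.Relation.Unary.AllPairs using (AllPairs; []; _∷_)
open import Data.Nat.Base using (ℕ; zero; suc; _≤_; _+_; _^_; z<s; s<s; s<s⁻¹)
import Data.Nat.Base as ℕ
import Data.Nat.Properties as ℕ
open import Data.Product.Base using (Σ-syntax; ∃-syntax; _×_; _,_; proj₁; proj₂)
open import Data.Product.Properties using (≡-dec)
open import Data.Vec.Base as Vec using (Vec; []; _∷_; count; allFin)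
open import Function.Base using (_∘_; id)
open import Function.Bundles using (Inverse)
import Function.Construct.Composition as Compose
import Function.Construct.Identity as Identity
import Function.Construct.Symmetry as Symmetry
open import Level using (Level; 0ℓ)
open import Relation.Binary.Bundles using (Setoid)
open import Relation.Binary.Definitions using (tri<; tri≈; tri>; _Respects_)
import Relation.Binary.Construct.On as On
open import Relation.Binary.PropositionalEquality
open import Relation.Nullary.Decidable
open import Relation.Nullary.Negation using (¬_; contradiction)
open import Relation.Unary using (Pred; Decidable; _∩_; ∁)
open import Relation.Unary.Properties using (∁?; _∩?_)

private
  variable
    a b ℓ ℓ₁ ℓ₂ p q : Level
    m n : ℕ

-- Subsetoids, their cardinalities and counts over `Fin n`.

-- Same shape as `Fibre`: `Fibre X f v` is by definition `Sub X (λ x → f x ≡ v)`, so everything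
-- shown for subsetoids applies to the fibres of the theorem.
Sub : (X : Setoid a ℓ) → Pred (Setoid.Carrier X) p → Setoid _ ℓ
Sub X P = On.setoid {B = Σ[ x ∈ Setoid.Carrier X ] P x} X proj₁

Sub-inverse : {X : Setoid a ℓ₁} {Y : Setoid b ℓ₂} (I : Inverse X Y) →
  {P : Pred (Setoid.Carrier X) p} {Q : Pred (Setoid.Carrier Y) q} →
  (∀ x → P x → Q (Inverse.to I x)) → (∀ y → Q y → P (Inverse.from I y)) →
  Inverse (Sub X P) (Sub Y Q)
Sub-inverse I P⇒Q Q⇒P = record
  { to        = λ (x , p) → to x , P⇒Q x p
  ; from      = λ (y , q) → from y , Q⇒P y q
  ; to-cong   = to-cong
  ; from-cong = from-cong
  ; inverse   = inverseˡ , inverseʳ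
  }
  where open Inverse I

HasCardinality-unique : {X : Setoid a ℓ} → HasCardinality X m → HasCardinality X n → m ≡ n
HasCardinality-unique I J = Perm.↔⇒≡ (Compose.inverse (Symmetry.inverse I) J)

HasCardinality-resp : {X : Setoid a ℓ} {P : Pred (Setoid.Carrier X) p} {Q : Pred (Setoid.Carrier X) q} →
  (∀ x → P x → Q x) → (∀ x → Q x → P x) → HasCardinality (Sub X P) n → HasCardinality (Sub X Q) n
HasCardinality-resp {X = X} P⇒Q Q⇒P = Compose.inverse (Sub-inverse (Identity.inverse X) Q⇒P P⇒Q)

HasCardinality-empty : {X : Setoid a ℓ} {P : Pred (Setoid.Carrier X) p} → (∀ x → ¬ P x) →
  HasCardinality (Sub X P) 0
HasCardinality-empty empty = record
  { to        = λ (x , p) → contradiction p (empty x)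
  ; from      = λ ()
  ; to-cong   = λ { {x , p} → contradiction p (empty x) }
  ; from-cong = λ { {()} }
  ; inverse   = (λ { {()} }) , (λ { {_} {()} })
  }

-- Links the `count` of the statistics to `HasCardinality`: an index satisfying `P` is sent to its
-- rank among such indices.
count-card : {A : Set a} {P : Pred A p} (P? : Decidable P) (f : Fin n → A) →
  HasCardinality (Sub (setoid (Fin n)) (P ∘ f)) (count P? (Vec.tabulate f))
count-card {n = zero} P? f = record
  { to        = λ ()
  ; from      = λ ()
  ; to-cong   = λ { {() , _} }
  ; from-cong = λ { {()} }
  ; inverse   = (λ { {()} }) , (λ { {() , _} })
  }
count-card {n = suc n} P? f with P? (f zero) | count-card P? (f ∘ suc)
... | yes p | I = record
  { to        = to′
  ; from      = from′
  ; to-cong   = to′-cong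
  ; from-cong = λ { refl → refl }
  ; inverse   = (λ {y} e → trans (to′-cong e) (invˡ y)) , (λ { {x} refl → invʳ x })
  }
  where
  open Inverse I
  to′ : _
  to′ (zero  , _) = zero
  to′ (suc i , q) = suc (to (i , q))
  from′ : _
  from′ zero    = zero , p
  from′ (suc k) = suc (proj₁ (from k)) , proj₂ (from k)
  to′-cong : ∀ {x y} → proj₁ x ≡ proj₁ y → to′ x ≡ to′ y
  to′-cong {zero  , _} {zero  , _} _ = refl
  to′-cong {suc i , _} {suc j , _} e = cong suc (to-cong (Fin.suc-injective e))
  invˡ : ∀ k → to′ (from′ k) ≡ k
  invˡ zero    = refl
  invˡ (suc k) = cong suc (strictlyInverseˡ k)
  invʳ : ∀ x → proj₁ (from′ (to′ x)) ≡ proj₁ x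
  invʳ (zero  , _) = refl
  invʳ (suc i , q) = cong suc (strictlyInverseʳ (i , q))
... | no ¬p | I = record
  { to        = to′
  ; from      = λ k → suc (proj₁ (from k)) , proj₂ (from k)
  ; to-cong   = to′-cong
  ; from-cong = λ { refl → refl }
  ; inverse   = (λ {y} e → trans (to′-cong e) (strictlyInverseˡ y)) , (λ { {x} refl → invʳ x })
  }
  where
  open Inverse I
  to′ : _
  to′ (zero  , q) = contradiction q ¬p
  to′ (suc i , q) = to (i , q)
  to′-cong : ∀ {x y} → proj₁ x ≡ proj₁ y → to′ x ≡ to′ y
  to′-cong {zero  , q} {_}         _ = contradiction q ¬p
  to′-cong {suc i , _} {suc j , _} e = to-cong (Fin.suc-injective e)
  invʳ : ∀ x → suc (proj₁ (from (to′ x))) ≡ proj₁ x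
  invʳ (zero  , q) = contradiction q ¬p
  invʳ (suc i , q) = cong suc (strictlyInverseʳ (i , q))

-- Both counts enumerate the same set, since `π` restricts to a bijection between the indices
-- satisfying `P` and those satisfying `Q`.
count-permute : {P : Pred (Fin m) p} {Q : Pred (Fin n) q}
  (P? : Decidable P) (Q? : Decidable Q) (π : Permutation m n) →
  (∀ i → P i → Q (π ⟨$⟩ʳ i)) → (∀ i → Q (π ⟨$⟩ʳ i) → P i) →
  count P? (allFin m) ≡ count Q? (allFin n)
count-permute {Q = Q} P? Q? π P⇒Q Q⇒P =
  HasCardinality-unique (count-card P? id)
    (Compose.inverse
      (Sub-inverse π P⇒Q (λ i q → Q⇒P _ (subst Q (sym (Perm.inverseʳ π)) q)))
      (count-card Q? id))

count-cong : {P : Pred (Fin n) p} {Q : Pred (Fin n) q} (P? : Decidable P) (Q? : Decidable Q) →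
  (∀ i → P i → Q i) → (∀ i → Q i → P i) → count P? (allFin n) ≡ count Q? (allFin n)
count-cong P? Q? = count-permute P? Q? Perm.id

count-tabulate : {A : Set a} {P : Pred A p} (P? : Decidable P) (f : Fin n → A) →
  count P? (Vec.tabulate f) ≡ count (P? ∘ f) (allFin n)
count-tabulate P? f = HasCardinality-unique (count-card P? f) (count-card (P? ∘ f) id)

count-suc⁺ : {P : Pred (Fin (suc n)) p} (P? : Decidable P) → P zero →
  count P? (allFin (suc n)) ≡ suc (count (P? ∘ suc) (allFin n))
count-suc⁺ P? p with P? zero
... | yes _ = cong suc (count-tabulate P? suc)
... | no ¬p = contradiction p ¬p

count-suc⁻ : {P : Pred (Fin (suc n)) p} (P? : Decidable P) → ¬ P zero →
  count P? (allFin (suc n)) ≡ count (P? ∘ suc) (allFin n)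
count-suc⁻ P? ¬p with P? zero
... | yes p = contradiction p ¬p
... | no _  = count-tabulate P? suc

count-unique : {P : Pred (Fin n) p} (P? : Decidable P) (i : Fin n) → P i → (∀ j → P j → j ≡ i) →
  count P? (allFin n) ≡ 1
count-unique P? i p unique = HasCardinality-unique (count-card P? id) record
  { to        = λ _ → zero
  ; from      = λ _ → i , p
  ; to-cong   = λ _ → refl
  ; from-cong = λ _ → refl
  ; inverse   = (λ { {zero} _ → refl }) , (λ {x} _ → sym (unique (proj₁ x) (proj₂ x)))
  }

count-split : {A : Set a} {P : Pred A p} {Q : Pred A q} (P? : Decidable P) (Q? : Decidable Q)
  (xs : Vec A n) → count P? xs ≡ count (P? ∩? Q?) xs + count (P? ∩? ∁? Q?) xs
count-split P? Q? [] = refl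
count-split P? Q? (x ∷ xs) with does (P? x) | does (Q? x)
... | true  | true  = cong suc (count-split P? Q? xs)
... | true  | false = trans (cong suc (count-split P? Q? xs)) (sym (ℕ.+-suc _ _))
... | false | _     = count-split P? Q? xs

module _ {X : Setoid a ℓ} (finite : HasCardinality X n) where

  open Setoid X using (_≈_) renaming (sym to ≈-sym)
  open Inverse finite using (from; strictlyInverseʳ)

  Sub-card : {P : Pred (Setoid.Carrier X) p} (P? : Decidable P) → P Respects _≈_ →
    HasCardinality (Sub X P) (count (P? ∘ from) (allFin n))
  Sub-card P? P-resp = Compose.inverse
    (Sub-inverse finite (λ x → P-resp (≈-sym (strictlyInverseʳ x))) (λ _ → id))
    (count-card (P? ∘ from) id)

  -- The two given bijections need not be compatible, so they do not restrict to the complement of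
  -- `Q`. Finiteness turns them into equalities of numbers, which can be subtracted.
  equinumerous-difference : {P P′ Q : Pred (Setoid.Carrier X) 0ℓ} →
    Decidable P → Decidable P′ → Decidable Q →
    P Respects _≈_ → P′ Respects _≈_ → Q Respects _≈_ →
    Inverse (Sub X P) (Sub X P′) → Inverse (Sub X (P ∩ Q)) (Sub X (P′ ∩ Q)) →
    ∃[ N ] HasCardinality (Sub X (P ∩ ∁ Q)) N × HasCardinality (Sub X (P′ ∩ ∁ Q)) N
  equinumerous-difference {P} {P′} {Q} P? P′? Q? P-resp P′-resp Q-resp I J =
    _ , Sub-card (P? ∩? ∁? Q?) (λ e (p , ¬q) → P-resp e p , ¬q ∘ Q-resp (≈-sym e)) ,
    subst (HasCardinality _) (sym difference)
      (Sub-card (P′? ∩? ∁? Q?) (λ e (p , ¬q) → P′-resp e p , ¬q ∘ Q-resp (≈-sym e)))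
    where
    # : {R : Pred (Setoid.Carrier X) 0ℓ} → Decidable R → ℕ
    # R? = count (R? ∘ from) (allFin n)
    whole : # P? ≡ # P′?
    whole = HasCardinality-unique (Sub-card P? P-resp) (Compose.inverse I (Sub-card P′? P′-resp))
    common : # (P? ∩? Q?) ≡ # (P′? ∩? Q?)
    common = HasCardinality-unique
      (Sub-card (P? ∩? Q?) (λ e (p , q) → P-resp e p , Q-resp e q))
      (Compose.inverse J (Sub-card (P′? ∩? Q?) (λ e (p , q) → P′-resp e p , Q-resp e q)))
    difference : # (P? ∩? ∁? Q?) ≡ # (P′? ∩? ∁? Q?)
    difference = ℕ.+-cancelˡ-≡ (# (P? ∩? Q?)) _ _ (begin
      # (P? ∩? Q?) + # (P? ∩? ∁? Q?)    ≡⟨ count-split (P? ∘ from) (Q? ∘ from) (allFin n) ⟨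
      # P?                              ≡⟨ whole ⟩
      # P′?                             ≡⟨ count-split (P′? ∘ from) (Q? ∘ from) (allFin n) ⟩
      # (P′? ∩? Q?) + # (P′? ∩? ∁? Q?)  ≡⟨ cong (_+ # (P′? ∩? ∁? Q?)) common ⟨
      # (P? ∩? Q?) + # (P′? ∩? ∁? Q?)   ∎)
      where open ≡-Reasoning

-- Right-to-left minima and left-to-right maxima.

module _ {f g : Fin n → Fin n} (f≗g : f ≗ g) where

  transport-< : ∀ {i j} → f i Fin.< f j → g i Fin.< g j
  transport-< {i} {j} = subst₂ Fin._<_ (f≗g i) (f≗g j)

RLMin : (Fin n → Fin n) → Pred (Fin n) 0ℓ
RLMin f i = ∀ j → i Fin.< j → f i Fin.< f j

rlMin? : (f : Fin n → Fin n) → Decidable (RLMin f)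
rlMin? f i = Fin.all? λ j → i Fin.<? j →-dec f i Fin.<? f j

LRMax : (Fin n → Fin n) → Pred (Fin n) 0ℓ
LRMax f i = ∀ j → j Fin.< i → f j Fin.< f i

lrMax? : (f : Fin n → Fin n) → Decidable (LRMax f)
lrMax? f i = Fin.all? λ j → j Fin.<? i →-dec f j Fin.<? f i

lookup-tabulate-cast : {A : Set a} (f : Fin n → A) (i : Fin (length (List.tabulate f))) →
  List.lookup (List.tabulate f) i ≡ f (cast (List.length-tabulate f) i)
lookup-tabulate-cast {n = suc n} f zero    = refl
lookup-tabulate-cast {n = suc n} f (suc i) = lookup-tabulate-cast (f ∘ suc) i

-- The length of `word π` equals `n` only propositionally, so positions in the list are matched with
-- `Fin n` by a cast, which preserves their order.
rlmin-count : (π : Permutation′ n) → rlmin π ≡ count (rlMin? (π ⟨$⟩ʳ_)) (allFin n)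
rlmin-count {n} π = count-permute (isRLMin? (word π)) (rlMin? (π ⟨$⟩ʳ_)) (Perm.cast-id len)
  (λ i min j i<j → s<s⁻¹ (subst₂ ℕ._<_ (letter i) (trans (letter (cast len⁻¹ j)) (cong f (Fin.cast-involutive len len⁻¹ j)))
    (min (cast len⁻¹ j) (subst₂ ℕ._<_ (Fin.toℕ-cast len i) (sym (Fin.toℕ-cast len⁻¹ j)) i<j))))
  (λ i min j i<j → subst₂ ℕ._<_ (sym (letter i)) (sym (letter j))
    (s<s (min (cast len j) (subst₂ ℕ._<_ (sym (Fin.toℕ-cast len i)) (sym (Fin.toℕ-cast len j)) i<j))))
  where
  f : Fin n → ℕ
  f i = suc (toℕ (π ⟨$⟩ʳ i))
  len : length (List.tabulate f) ≡ n
  len = List.length-tabulate f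
  len⁻¹ : n ≡ length (List.tabulate f)
  len⁻¹ = sym len
  letter : ∀ i → List.lookup (List.tabulate f) i ≡ f (cast len i)
  letter = lookup-tabulate-cast f

⟨$⟩ʳ-injective : (π : Permutation′ n) {i j : Fin n} → π ⟨$⟩ʳ i ≡ π ⟨$⟩ʳ j → i ≡ j
⟨$⟩ʳ-injective π {i} {j} e = trans (sym (Perm.inverseˡ π)) (trans (cong (π ⟨$⟩ˡ_) e) (Perm.inverseˡ π))

-- By the pigeonhole principle some `j ≤ i` has `i ≤ π j`. As `i` is a left-to-right maximum,
-- `π j ≤ π i`.
LRMax⇒WeakExcedance : (π : Permutation′ n) {i : Fin n} → LRMax (π ⟨$⟩ʳ_) i → WeakExcedance π i
LRMax⇒WeakExcedance π {i} max with Fin.injective⇒existsPivot (⟨$⟩ʳ-injective π) i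
... | j , j≤i , i≤πj with j Fin.≟ i
...   | yes refl = i≤πj
...   | no j≢i   = ℕ.≤-trans i≤πj (ℕ.<⇒≤ (max j (Fin.≤∧≢⇒< j≤i j≢i)))

-- If j < i and π j > π i, while every later letter exceeds π i, then j and the
-- positions of the letters below π i are π i + 1 positions before i.
WeakExcedance∧¬MidPoint⇒LRMax : (π : Permutation′ n) {i : Fin n} →
  WeakExcedance π i → ¬ MidPoint π i → LRMax (π ⟨$⟩ʳ_) i
WeakExcedance∧¬MidPoint⇒LRMax {n} π {i} exc ¬mid j j<i with Fin.<-cmp (π ⟨$⟩ʳ j) (π ⟨$⟩ʳ i)
... | tri< lt _ _ = lt
... | tri≈ _ eq _ = contradiction (cong toℕ (⟨$⟩ʳ-injective π eq)) (ℕ.<⇒≢ j<i)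
-- Injecting π i + 1 positions into the i earlier ones contradicts i ≤ π i.
... | tri> _ _ πi<πj = contradiction (Fin.injective⇒≤ early-injective) (ℕ.<⇒≱ (s<s exc))
  where
  at : Fin (suc (toℕ (π ⟨$⟩ʳ i))) → Fin n
  at zero    = j
  at (suc v) = π ⟨$⟩ˡ Fin.inject v

  π∘at-suc : ∀ v → π ⟨$⟩ʳ at (suc v) Fin.< π ⟨$⟩ʳ i
  π∘at-suc v = subst (Fin._< π ⟨$⟩ʳ i) (sym (Perm.inverseʳ π))
    (subst (ℕ._< _) (sym (Fin.toℕ-inject v)) (Fin.toℕ<n v))

  at-injective : ∀ {u v} → at u ≡ at v → u ≡ v
  at-injective {zero}  {zero}  _ = refl
  at-injective {zero}  {suc v} e = contradiction (subst (λ k → π ⟨$⟩ʳ k Fin.< π ⟨$⟩ʳ i) (sym e) (π∘at-suc v)) (ℕ.<⇒≯ πi<πj)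
  at-injective {suc u} {zero}  e = contradiction (subst (λ k → π ⟨$⟩ʳ k Fin.< π ⟨$⟩ʳ i) e (π∘at-suc u)) (ℕ.<⇒≯ πi<πj)
  at-injective {suc u} {suc v} e = cong suc (Fin.toℕ-injective (subst₂ _≡_ (Fin.toℕ-inject u) (Fin.toℕ-inject v)
    (cong toℕ (⟨$⟩ʳ-injective (flip π) e))))

  at<i : ∀ v → at v Fin.< i
  at<i zero    = j<i
  at<i (suc v) with Fin.<-cmp (at (suc v)) i
  ... | tri< lt _ _  = lt
  ... | tri≈ _ eq _  = contradiction (cong (λ k → toℕ (π ⟨$⟩ʳ k)) eq) (ℕ.<⇒≢ (π∘at-suc v))
  ... | tri> _ _ i<k = contradiction ((j , j<i , πi<πj) , at (suc v) , i<k , π∘at-suc v) ¬mid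

  early : Fin (suc (toℕ (π ⟨$⟩ʳ i))) → Fin (toℕ i)
  early v = fromℕ< (at<i v)

  early-injective : ∀ {u v} → early u ≡ early v → u ≡ v
  early-injective {u} {v} e = at-injective (Fin.toℕ-injective (Fin.fromℕ<-injective _ _ (at<i u) (at<i v) e))

wm̄-count : (π : Permutation′ n) → wm̄ π ≡ count (lrMax? (π ⟨$⟩ʳ_)) (allFin n)
wm̄-count π = count-cong _ (lrMax? (π ⟨$⟩ʳ_))
  (λ i (exc , ¬mid) → WeakExcedance∧¬MidPoint⇒LRMax π exc ¬mid)
  (λ i max → LRMax⇒WeakExcedance π max , λ ((j , j<i , πj>πi) , _) → ℕ.<⇒≯ πj>πi (max j j<i))

-- Invariance of the statistics under pointwise equality.

module _ (π ρ : Permutation′ n) (π≈ρ : π Perm.≈ ρ) where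

  -- `Perm.≈` compares forward maps only, so agreement of the inverses, on which `ides` depends, has
  -- to be derived.
  flip-cong : flip π Perm.≈ flip ρ
  flip-cong i = begin
    π ⟨$⟩ˡ i                      ≡⟨ Perm.inverseˡ ρ ⟨
    ρ ⟨$⟩ˡ (ρ ⟨$⟩ʳ (π ⟨$⟩ˡ i))    ≡⟨ cong (ρ ⟨$⟩ˡ_) (π≈ρ (π ⟨$⟩ˡ i)) ⟨
    ρ ⟨$⟩ˡ (π ⟨$⟩ʳ (π ⟨$⟩ˡ i))    ≡⟨ cong (ρ ⟨$⟩ˡ_) (Perm.inverseʳ π) ⟩
    ρ ⟨$⟩ˡ i                      ∎
    where open ≡-Reasoning

  rlmin-cong : rlmin π ≡ rlmin ρ
  rlmin-cong = trans (rlmin-count π) (trans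
    (count-cong (rlMin? (π ⟨$⟩ʳ_)) (rlMin? (ρ ⟨$⟩ʳ_))
                    (λ i min j i<j → transport-< π≈ρ (min j i<j))
                    (λ i min j i<j → transport-< (sym ∘ π≈ρ) (min j i<j)))
    (sym (rlmin-count ρ)))

  wm̄-cong : wm̄ π ≡ wm̄ ρ
  wm̄-cong = trans (wm̄-count π) (trans
    (count-cong (lrMax? (π ⟨$⟩ʳ_)) (lrMax? (ρ ⟨$⟩ʳ_))
                    (λ i max j j<i → transport-< π≈ρ (max j j<i))
                    (λ i max j j<i → transport-< (sym ∘ π≈ρ) (max j j<i)))
    (sym (wm̄-count ρ)))

descent? : (π : Permutation′ (suc n)) → Decidable (λ i → π ⟨$⟩ʳ suc i Fin.< π ⟨$⟩ʳ inject₁ i)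
descent? π i = (π ⟨$⟩ʳ suc i) Fin.<? (π ⟨$⟩ʳ inject₁ i)

des-cong : (π ρ : Permutation′ n) → π Perm.≈ ρ → des π ≡ des ρ
des-cong {zero}  π ρ π≈ρ = refl
des-cong {suc n} π ρ π≈ρ = count-cong (descent? π) (descent? ρ) (λ _ → transport-< π≈ρ) (λ _ → transport-< (sym ∘ π≈ρ))

-- Reverse-complement.

opposite-anti : {i j : Fin n} → i Fin.< j → opposite j Fin.< opposite i
opposite-anti {n} {i} {j} i<j rewrite Fin.opposite-prop i | Fin.opposite-prop j =
  ℕ.∸-monoʳ-< (s<s i<j) (Fin.toℕ<n j)

opposite-anti⁻¹ : {i j : Fin n} → opposite i Fin.< opposite j → j Fin.< i
opposite-anti⁻¹ lt = subst₂ Fin._<_ (Fin.opposite-involutive _) (Fin.opposite-involutive _) (opposite-anti lt)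

-- Together with `opposite (suc i) = inject₁ (opposite i)`, which holds by computation, this makes
-- reversal send consecutive positions to consecutive positions with their order swapped.
opposite-inject₁ : (i : Fin n) → opposite (inject₁ i) ≡ suc (opposite i)
opposite-inject₁ {suc n} zero    = refl
opposite-inject₁ {suc n} (suc i) = cong inject₁ (opposite-inject₁ i)

reverseComplement : Permutation′ n → Permutation′ n
reverseComplement π = Perm.reverse ∘ₚ π ∘ₚ Perm.reverse

module _ (π : Permutation′ n) where

  private
    f : Fin n → Fin n
    f = π ⟨$⟩ʳ_

    opposite² : ∀ {i} → f (opposite (opposite i)) ≡ f i
    opposite² = cong f (Fin.opposite-involutive _)

  reverseComplement-involutive : reverseComplement (reverseComplement π) Perm.≈ π
  reverseComplement-involutive i = trans (Fin.opposite-involutive _) opposite²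

  -- Reversal exchanges right with left and complementation exchanges minima with maxima, so
  -- right-to-left minima correspond to left-to-right maxima at mirrored positions.
  rlmin-reverseComplement : rlmin (reverseComplement π) ≡ wm̄ π
  rlmin-reverseComplement = trans (rlmin-count (reverseComplement π)) (trans
    (count-permute (rlMin? (reverseComplement π ⟨$⟩ʳ_)) (lrMax? f) Perm.reverse
      (λ i min j j<i′ → opposite-anti⁻¹ (subst (λ k → opposite (f (opposite i)) Fin.< opposite k) opposite²
         (min (opposite j) (subst (Fin._< opposite j) (Fin.opposite-involutive i) (opposite-anti j<i′)))))
      (λ i max j i<j → opposite-anti (max (opposite j) (opposite-anti i<j))))
    (sym (wm̄-count π)))

-- Reversing 321 gives 123 and complementing gives 321 again, so an occurrence yields one at the
-- mirrored positions.
Avoids321-reverseComplement : (π : Permutation′ n) → Avoids321 π → Avoids321 (reverseComplement π)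
Avoids321-reverseComplement π av (i , j , k , i<j , j<k , >₁ , >₂) =
  av (opposite k , opposite j , opposite i , opposite-anti j<k , opposite-anti i<j ,
      opposite-anti⁻¹ >₂ , opposite-anti⁻¹ >₁)

wm̄-reverseComplement : (π : Permutation′ n) → wm̄ (reverseComplement π) ≡ rlmin π
wm̄-reverseComplement π = trans (sym (rlmin-reverseComplement (reverseComplement π)))
  (rlmin-cong (reverseComplement (reverseComplement π)) π (reverseComplement-involutive π))

-- Reversal and complementation each turn descents into ascents, so together they preserve descents,
-- at mirrored gaps.
des-reverseComplement : (π : Permutation′ n) → des (reverseComplement π) ≡ des π
des-reverseComplement {zero}  π = refl
des-reverseComplement {suc n} π = count-permute (descent? (reverseComplement π)) (descent? π) Perm.reverse
  (λ i d → subst (λ k → f k Fin.< f (inject₁ (opposite i))) (opposite-inject₁ i) (opposite-anti⁻¹ d))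
  (λ i d → opposite-anti (subst (λ k → f k Fin.< f (inject₁ (opposite i))) (sym (opposite-inject₁ i)) d))
  where f = π ⟨$⟩ʳ_

-- Prepending a fixed point: the permutation 1 ⊕ σ.

module _ (σ : Permutation′ n) where

  -- The new first letter is the smallest, hence a right-to-left minimum. Standing before all
  -- others, it does not affect their status.
  rlmin-lift₀ : rlmin (lift₀ σ) ≡ suc (rlmin σ)
  rlmin-lift₀ = begin
    rlmin (lift₀ σ)                                            ≡⟨ rlmin-count (lift₀ σ) ⟩
    count (rlMin? (lift₀ σ ⟨$⟩ʳ_)) (allFin (suc n))            ≡⟨ count-suc⁺ (rlMin? (lift₀ σ ⟨$⟩ʳ_)) (λ { (suc j) _ → z<s }) ⟩
    suc (count (rlMin? (lift₀ σ ⟨$⟩ʳ_) ∘ suc) (allFin n))      ≡⟨ cong suc (count-cong _ (rlMin? (σ ⟨$⟩ʳ_))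
                                                                     (λ i min j i<j → s<s⁻¹ (min (suc j) (s<s i<j)))
                                                                     (λ { i min (suc j) i<j → s<s (min j (s<s⁻¹ i<j)) })) ⟩
    suc (count (rlMin? (σ ⟨$⟩ʳ_)) (allFin n))                  ≡⟨ cong suc (rlmin-count σ) ⟨
    suc (rlmin σ)                                              ∎
    where open ≡-Reasoning

  -- The first letter is vacuously a left-to-right maximum. Being the smallest, it prevents no later
  -- letter from being one.
  wm̄-lift₀ : wm̄ (lift₀ σ) ≡ suc (wm̄ σ)
  wm̄-lift₀ = begin
    wm̄ (lift₀ σ)                                               ≡⟨ wm̄-count (lift₀ σ) ⟩
    count (lrMax? (lift₀ σ ⟨$⟩ʳ_)) (allFin (suc n))            ≡⟨ count-suc⁺ (lrMax? (lift₀ σ ⟨$⟩ʳ_)) (λ _ ()) ⟩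
    suc (count (lrMax? (lift₀ σ ⟨$⟩ʳ_) ∘ suc) (allFin n))      ≡⟨ cong suc (count-cong _ (lrMax? (σ ⟨$⟩ʳ_))
                                                                     (λ i max j j<i → s<s⁻¹ (max (suc j) (s<s j<i)))
                                                                     (λ { i max zero _ → z<s ; i max (suc j) j<i → s<s (max j (s<s⁻¹ j<i)) })) ⟩
    suc (count (lrMax? (σ ⟨$⟩ʳ_)) (allFin n))                  ≡⟨ cong suc (wm̄-count σ) ⟨
    suc (wm̄ σ)                                                 ∎
    where open ≡-Reasoning

-- The gap after the prepended letter is an ascent, and the remaining gaps are those of `σ`.
des-lift₀ : (σ : Permutation′ n) → des (lift₀ σ) ≡ des σ
des-lift₀ {zero}  σ = refl
des-lift₀ {suc n} σ = trans
  (count-suc⁻ (descent? (lift₀ σ)) (λ ()))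
  (count-cong (descent? (lift₀ σ) ∘ suc) (descent? σ) (λ _ → s<s⁻¹) (λ _ → s<s))

ides-lift₀ : (σ : Permutation′ n) → ides (lift₀ σ) ≡ ides σ
ides-lift₀ σ = trans (des-cong (flip (lift₀ σ)) (lift₀ (flip σ)) flip-lift₀) (des-lift₀ (flip σ))
  where
  flip-lift₀ : flip (lift₀ σ) Perm.≈ lift₀ (flip σ)
  flip-lift₀ zero    = refl
  flip-lift₀ (suc i) = refl

-- Position 0 carries the smallest letter, so it cannot be the 3 of a pattern; as the first position
-- it cannot be the 2 or the 1.
Avoids321-lift₀ : (σ : Permutation′ n) → Avoids321 σ → Avoids321 (lift₀ σ)
Avoids321-lift₀ σ av (suc i , suc j , suc k , i<j , j<k , >₁ , >₂) =
  av (i , j , k , s<s⁻¹ i<j , s<s⁻¹ j<k , s<s⁻¹ >₁ , s<s⁻¹ >₂)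

Avoids321-lift₀⁻¹ : (σ : Permutation′ n) → Avoids321 (lift₀ σ) → Avoids321 σ
Avoids321-lift₀⁻¹ σ av (i , j , k , i<j , j<k , >₁ , >₂) =
  av (suc i , suc j , suc k , s<s i<j , s<s j<k , s<s >₁ , s<s >₂)

-- The letters before 1 and the values of `rlm`.

AllPairs-lookup : {A : Set a} {R : A → A → Set ℓ} {xs : List A} → AllPairs R xs →
  ∀ {i j} → i Fin.< j → R (List.lookup xs i) (List.lookup xs j)
AllPairs-lookup (all ∷ _) {zero}  {suc j} _   = All.lookup all (∈-lookup j)
AllPairs-lookup (_ ∷ ps)  {suc i} {suc j} i<j = AllPairs-lookup ps (s<s⁻¹ i<j)

-- In an increasing word every letter except the last has a larger one after it.
#RLMax-ascending : ∀ {x xs} → AllPairs ℕ._<_ (x ∷ xs) → #RLMax (x ∷ xs) ≡ 1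
#RLMax-ascending {x} {xs} asc = count-unique (isRLMax? (x ∷ xs)) (fromℕ (length xs))
  (λ j last<j → contradiction (Fin.≤fromℕ j) (ℕ.<⇒≱ last<j))
  only-last
  where
  only-last : ∀ j → IsRLMax (x ∷ xs) j → j ≡ fromℕ (length xs)
  only-last j max with j Fin.≟ fromℕ (length xs)
  ... | yes eq = eq
  ... | no neq = contradiction (max _ j<last) (ℕ.<⇒≯ (AllPairs-lookup asc j<last))
    where j<last = Fin.≤∧≢⇒< (Fin.≤fromℕ j) neq

-- As `Q` fails at `k`, the prefix stops at `k` at the latest, so `P` is required only before `k`.
-- In the application `k` is the position of the letter 1.
takeWhile-tabulate-All : {A : Set a} {P : Pred A p} {Q : Pred A q} (Q? : Decidable Q)
  (f : Fin n → A) (k : Fin n) → ¬ Q (f k) → (∀ j → j Fin.< k → P (f j)) →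
  All P (List.takeWhile Q? (List.tabulate f))
takeWhile-tabulate-All {n = suc n} Q? f k ¬q before with Q? (f zero)
... | no _ = []
takeWhile-tabulate-All Q? f zero    ¬q before | yes q0 = contradiction q0 ¬q
takeWhile-tabulate-All Q? f (suc k) ¬q before | yes q0 =
  before zero z<s ∷ takeWhile-tabulate-All Q? (f ∘ suc) k ¬q (λ j j<k → before (suc j) (s<s j<k))

takeWhile-tabulate-AllPairs : {A : Set a} {R : A → A → Set ℓ} {Q : Pred A q} (Q? : Decidable Q)
  (f : Fin n → A) (k : Fin n) → ¬ Q (f k) → (∀ i j → i Fin.< j → j Fin.< k → R (f i) (f j)) →
  AllPairs R (List.takeWhile Q? (List.tabulate f))
takeWhile-tabulate-AllPairs {n = suc n} Q? f k ¬q before with Q? (f zero)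
... | no _ = []
takeWhile-tabulate-AllPairs Q? f zero    ¬q before | yes q0 = contradiction q0 ¬q
takeWhile-tabulate-AllPairs Q? f (suc k) ¬q before | yes q0 =
  takeWhile-tabulate-All Q? (f ∘ suc) k ¬q (λ j j<k → before zero (suc j) z<s (s<s j<k)) ∷
  takeWhile-tabulate-AllPairs Q? (f ∘ suc) k ¬q
    (λ i j i<j j<k → before (suc i) (suc j) (s<s i<j) (s<s j<k))

≢1? : Decidable (_≢ 1)
≢1? x = ¬? (x ℕ.≟ 1)

rlm-fixed : (π : Permutation′ (suc n)) → π ⟨$⟩ʳ zero ≡ zero → rlm π ≡ 0
rlm-fixed π π0≡0 rewrite π0≡0 = refl

-- Two letters in decreasing order to the left of the letter 1 would form a 321
-- with it, so the word before 1 is increasing and only its last letter counts.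
rlm-moved : (π : Permutation′ (suc n)) → Avoids321 π → π ⟨$⟩ʳ zero ≢ zero → rlm π ≡ 1
rlm-moved {n} π av π0≢0 = go (takeWhile-tabulate-AllPairs ≢1? f (π ⟨$⟩ˡ zero)
  (contradiction (cong (suc ∘ toℕ) (Perm.inverseʳ π))) ascending)
  where
  f : Fin (suc n) → ℕ
  f i = suc (toℕ (π ⟨$⟩ʳ i))
  ascending : ∀ i j → i Fin.< j → j Fin.< π ⟨$⟩ˡ zero → f i ℕ.< f j
  ascending i j i<j j<k with Fin.<-cmp (π ⟨$⟩ʳ i) (π ⟨$⟩ʳ j)
  ... | tri< lt _ _ = s<s lt
  ... | tri≈ _ eq _ = contradiction (⟨$⟩ʳ-injective π eq) (Fin.<⇒≢ i<j)
  ... | tri> _ _ πi>πj = contradiction (i , j , π ⟨$⟩ˡ zero , i<j , j<k , πi>πj , positive) av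
    where
    positive : π ⟨$⟩ʳ (π ⟨$⟩ˡ zero) Fin.< π ⟨$⟩ʳ j
    -- The letter at `j` is not the smallest one, because `j` is not the position of that letter.
    positive = subst (Fin._< π ⟨$⟩ʳ j) (sym (Perm.inverseʳ π)) (ℕ.n≢0⇒n>0 λ e →
      Fin.<⇒≢ j<k (trans (sym (Perm.inverseˡ π)) (cong (π ⟨$⟩ˡ_) (Fin.toℕ-injective e))))
  go : AllPairs ℕ._<_ (List.takeWhile ≢1? (word π)) → #RLMax (List.takeWhile ≢1? (word π)) ≡ 1
  -- Exposing the first letter as a successor lets `takeWhile` compute to a nonempty list.
  go asc with π ⟨$⟩ʳ zero
  ... | zero  = contradiction refl π0≢0
  ... | suc _ = #RLMax-ascending asc

-- Finiteness of Sₙ(321).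

-- `Avoids321 π` is by definition the negation of this for the forward map of `π`. Stating it for
-- bare functions makes it apply to decoded codes.
Contains321 : (Fin n → Fin n) → Set
Contains321 f = ∃[ i ] ∃[ j ] ∃[ k ] i Fin.< j × j Fin.< k × f i Fin.> f j × f j Fin.> f k

Avoids321-resp : {f g : Fin n → Fin n} → f ≗ g → ¬ Contains321 f → ¬ Contains321 g
Avoids321-resp f≗g av (i , j , k , i<j , j<k , >₁ , >₂) =
  av (i , j , k , i<j , j<k , transport-< (sym ∘ f≗g) >₁ , transport-< (sym ∘ f≗g) >₂)

-- Functions Fin n → Fin n are coded by Fin (n ^ n); avoiding permutations are the
-- codes of those functions that have a (coded) inverse and avoid 321.
S₃₂₁-finite : ∀ n → ∃[ N ] HasCardinality (S₃₂₁ n) N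
S₃₂₁-finite n = _ , Compose.inverse coded (count-card Code? id)
  where
  ⟦_⟧ : Fin (n ^ n) → Fin n → Fin n
  ⟦_⟧ = finToFun

  Code : Pred (Fin (n ^ n)) 0ℓ
  Code c = (∃[ d ] (∀ i → ⟦ c ⟧ (⟦ d ⟧ i) ≡ i) × (∀ i → ⟦ d ⟧ (⟦ c ⟧ i) ≡ i)) ×
    ¬ Contains321 ⟦ c ⟧

  Code? : Decidable Code
  Code? c =
    Fin.any? (λ d → Fin.all? (λ i → ⟦ c ⟧ (⟦ d ⟧ i) Fin.≟ i) ×-dec Fin.all? (λ i → ⟦ d ⟧ (⟦ c ⟧ i) Fin.≟ i)) ×-dec
    ¬? (Fin.any? λ i → Fin.any? λ j → Fin.any? λ k →
      i Fin.<? j ×-dec j Fin.<? k ×-dec ⟦ c ⟧ j Fin.<? ⟦ c ⟧ i ×-dec ⟦ c ⟧ k Fin.<? ⟦ c ⟧ j)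

  funToFin-cong : ∀ {m} {f g : Fin m → Fin n} → f ≗ g → funToFin f ≡ funToFin g
  funToFin-cong {zero}  f≗g = refl
  funToFin-cong {suc m} f≗g = cong₂ Fin.combine (f≗g zero) (funToFin-cong (f≗g ∘ suc))

  decode∘encode : (f : Fin n → Fin n) → f ≗ ⟦ funToFin f ⟧
  decode∘encode f i = sym (Fin.finToFun-funToFin f i)

  coded : Inverse (S₃₂₁ n) (Sub (setoid (Fin (n ^ n))) Code)
  coded = record
    { to        = λ (π , av) → funToFin (π ⟨$⟩ʳ_) ,
        (funToFin (π ⟨$⟩ˡ_) ,
         (λ i → trans (sym (decode∘encode (π ⟨$⟩ʳ_) _))
                      (trans (cong (π ⟨$⟩ʳ_) (sym (decode∘encode (π ⟨$⟩ˡ_) i))) (Perm.inverseʳ π))) ,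
         (λ i → trans (sym (decode∘encode (π ⟨$⟩ˡ_) _))
                      (trans (cong (π ⟨$⟩ˡ_) (sym (decode∘encode (π ⟨$⟩ʳ_) i))) (Perm.inverseˡ π)))) ,
        Avoids321-resp (decode∘encode (π ⟨$⟩ʳ_)) av
    ; from      = λ (c , (d , invˡ , invʳ) , av) → permutation ⟦ c ⟧ ⟦ d ⟧ invˡ invʳ , av
    ; to-cong   = funToFin-cong
    ; from-cong = λ { refl i → refl }
    ; inverse   = (λ {(c , _)} e → trans (funToFin-cong e) (Fin.funToFin-finToFin {n} c)) ,
                  (λ { {π , _} refl i → Fin.finToFun-funToFin (π ⟨$⟩ʳ_) i })
    }

-- Bijections on Sₙ(321).

module S₃₂₁ (n : ℕ) = Setoid (S₃₂₁ n)

reverseComplement₃₂₁ : S₃₂₁.Carrier n → S₃₂₁.Carrier n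
reverseComplement₃₂₁ (π , av) = reverseComplement π , Avoids321-reverseComplement π av

reverseComplement-inverse : ∀ n → Inverse (S₃₂₁ n) (S₃₂₁ n)
reverseComplement-inverse n = record
  { to        = reverseComplement₃₂₁
  ; from      = reverseComplement₃₂₁
  ; to-cong   = λ {x} {y} → rc-cong x y
  ; from-cong = λ {x} {y} → rc-cong x y
  ; inverse   = (λ {x} {y} → rc-inverse x y) , (λ {x} {y} → rc-inverse x y)
  }
  where
  open S₃₂₁ n using (_≈_)
  rc-cong : ∀ x y → x ≈ y → reverseComplement₃₂₁ x ≈ reverseComplement₃₂₁ y
  rc-cong x y x≈y i = cong opposite (x≈y (opposite i))
  rc-inverse : ∀ x y → y ≈ reverseComplement₃₂₁ x → reverseComplement₃₂₁ y ≈ x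
  rc-inverse x y y≈rcx i =
    trans (rc-cong y (reverseComplement₃₂₁ x) y≈rcx i) (reverseComplement-involutive (proj₁ x) i)

Fixes0 : Pred (S₃₂₁.Carrier (suc n)) 0ℓ
Fixes0 (π , _) = π ⟨$⟩ʳ zero ≡ zero

fixes0? : Decidable (Fixes0 {n})
fixes0? (π , _) = π ⟨$⟩ʳ zero Fin.≟ zero

lift₃₂₁ : S₃₂₁.Carrier n → S₃₂₁.Carrier (suc n)
lift₃₂₁ (σ , av) = lift₀ σ , Avoids321-lift₀ σ av

-- The bijection between the permutations with π₁ = 1 and Sₙ(321) that deletes the first letter,
-- with inverse σ ↦ 1 ⊕ σ. An arbitrary invariant `P` is carried along so that it can be used on
-- fibres.
Fixes0-inverse : ∀ n {P : Pred (S₃₂₁.Carrier (suc n)) 0ℓ} → P Respects S₃₂₁._≈_ (suc n) →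
  Inverse (Sub (S₃₂₁ (suc n)) (P ∩ Fixes0)) (Sub (S₃₂₁ n) (P ∘ lift₃₂₁))
Fixes0-inverse n {P} P-resp = record
  { to        = to
  ; from      = from
  ; to-cong   = λ {x} {y} → to-cong x y
  ; from-cong = λ {x} {y} → from-cong x y
  ; inverse   = (λ {y} {x} → to-cong x (from y)) ,
                (λ {x} {y} e i → trans (from-cong y (to x) e i) (lift-remove x i))
  }
  where
  module X = Setoid (Sub (S₃₂₁ (suc n)) (P ∩ Fixes0))
  module Y = Setoid (Sub (S₃₂₁ n) (P ∘ lift₃₂₁))
  lift-remove : (x : X.Carrier) → lift₀ (remove zero (proj₁ (proj₁ x))) Perm.≈ proj₁ (proj₁ x)
  lift-remove ((π , _) , _ , fixes) = Perm.lift₀-remove π fixes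
  to : X.Carrier → Y.Carrier
  to x@((π , av) , p , _) = y , P-resp {π , av} {lift₃₂₁ y} (λ i → sym (lift-remove x i)) p
    where
    y : S₃₂₁.Carrier n
    y = remove zero π , Avoids321-lift₀⁻¹ (remove zero π) (Avoids321-resp (λ i → sym (lift-remove x i)) av)
  from : Y.Carrier → X.Carrier
  from (y , p) = lift₃₂₁ y , p , refl
  to-cong : ∀ x y → x X.≈ y → to x Y.≈ to y
  -- Equality after deletion is read off from the lifts, which agree with the original permutations.
  to-cong x y x≈y i = Fin.suc-injective
    (trans (lift-remove x (suc i)) (trans (x≈y (suc i)) (sym (lift-remove y (suc i)))))
  from-cong : ∀ x y → x Y.≈ y → from x X.≈ from y
  from-cong x y x≈y zero    = refl
  from-cong x y x≈y (suc i) = cong suc (x≈y i)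

-- The four statistics other than `rlm`.

Statistics : Set
Statistics = ℕ × ℕ × ℕ × ℕ

_≟ₛ_ : (s t : Statistics) → Dec (s ≡ t)
_≟ₛ_ = ≡-dec ℕ._≟_ (≡-dec ℕ._≟_ (≡-dec ℕ._≟_ ℕ._≟_))

-- The effect of reverse-complement; `exchange ∘ statistics` is the second tuple of the theorem
-- without `rlm`.
exchange : Statistics → Statistics
exchange (a , b , c , d) = b , a , c , d

extend : Statistics → Statistics
extend (a , b , c , d) = suc a , suc b , c , d

statistics : S₃₂₁.Carrier n → Statistics
statistics (π , _) = rlmin π , wm̄ π , des π , ides π

statistics-cong : (x y : S₃₂₁.Carrier n) → S₃₂₁._≈_ n x y → statistics x ≡ statistics y
statistics-cong (π , _) (ρ , _) e =
  cong₂ _,_ (rlmin-cong π ρ e) (cong₂ _,_ (wm̄-cong π ρ e)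
    (cong₂ _,_ (des-cong π ρ e) (des-cong (flip π) (flip ρ) (flip-cong π ρ e))))

statistics-reverseComplement : (x : S₃₂₁.Carrier n) →
  statistics (reverseComplement₃₂₁ x) ≡ exchange (statistics x)
statistics-reverseComplement (π , _) =
  -- Reverse-complement commutes with inversion by computation, so the descent identity for `flip π`
  -- serves for `ides`.
  cong₂ _,_ (rlmin-reverseComplement π) (cong₂ _,_ (wm̄-reverseComplement π)
    (cong₂ _,_ (des-reverseComplement π) (des-reverseComplement (flip π))))

statistics-lift : (x : S₃₂₁.Carrier n) → statistics (lift₃₂₁ x) ≡ extend (statistics x)
statistics-lift (σ , _) =
  cong₂ _,_ (rlmin-lift₀ σ) (cong₂ _,_ (wm̄-lift₀ σ) (cong₂ _,_ (des-lift₀ σ) (ides-lift₀ σ)))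

-- Prepending shifts the two exchanged statistics equally, so `extend` commutes with `exchange`.
statistics-lift-reverseComplement : (x : S₃₂₁.Carrier n) →
  statistics (lift₃₂₁ (reverseComplement₃₂₁ x)) ≡ exchange (statistics (lift₃₂₁ x))
statistics-lift-reverseComplement x = begin
  statistics (lift₃₂₁ (reverseComplement₃₂₁ x))  ≡⟨ statistics-lift (reverseComplement₃₂₁ x) ⟩
  extend (statistics (reverseComplement₃₂₁ x))   ≡⟨ cong extend (statistics-reverseComplement x) ⟩
  extend (exchange (statistics x))               ≡⟨ cong exchange (statistics-lift x) ⟨
  exchange (statistics (lift₃₂₁ x))              ∎
  where open ≡-Reasoning

-- Equinumerosity on the classes π₁ = 1 and π₁ ≠ 1.

module _ {n : ℕ} (w : Statistics) where

  private
    S : Setoid 0ℓ 0ℓ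
    S = S₃₂₁ (suc n)

    open S₃₂₁ (suc n) using (Carrier; _≈_)

    finite : HasCardinality S _
    finite = proj₂ (S₃₂₁-finite (suc n))

    P P′ : Pred Carrier 0ℓ
    P x = statistics x ≡ w
    P′ x = exchange (statistics x) ≡ w

    P-resp : P Respects _≈_
    P-resp {x} {y} e p = trans (sym (statistics-cong x y e)) p

    P′-resp : P′ Respects _≈_
    P′-resp {x} {y} e p = trans (cong exchange (sym (statistics-cong x y e))) p

    Fixes0-resp : Fixes0 Respects _≈_
    Fixes0-resp e fixes = trans (sym (e zero)) fixes

    P? : Decidable P
    P? x = statistics x ≟ₛ w

  all-equinumerous : Inverse (Sub S P) (Sub S P′)
  all-equinumerous = Sub-inverse (reverseComplement-inverse (suc n))
    -- Exchanging twice gives back the original quadruple by computation.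
    (λ x → trans (cong exchange (statistics-reverseComplement x)))
    (λ x → trans (statistics-reverseComplement x))

  -- Reverse-complementing 1 ⊕ σ itself may lose π₁ = 1, so the bijection used is 1 ⊕ σ ↦ 1 ⊕ σ′
  -- with σ′ the reverse-complement of σ.
  Fixes0-equinumerous : Inverse (Sub S (P ∩ Fixes0)) (Sub S (P′ ∩ Fixes0))
  Fixes0-equinumerous = Compose.inverse
    (Fixes0-inverse n {P} (λ {x} {y} → P-resp {x} {y})) (Compose.inverse
    (Sub-inverse (reverseComplement-inverse n)
      (λ x → trans (cong exchange (statistics-lift-reverseComplement x)))
      (λ x → trans (statistics-lift-reverseComplement x)))
    (Symmetry.inverse (Fixes0-inverse n {P′} (λ {x} {y} → P′-resp {x} {y}))))

  Fixes0-card : ∃[ N ] HasCardinality (Sub S (P ∩ Fixes0)) N × HasCardinality (Sub S (P′ ∩ Fixes0)) N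
  Fixes0-card = _ , card , Compose.inverse (Symmetry.inverse Fixes0-equinumerous) card
    where
    card = Sub-card finite (P? ∩? fixes0?)
      (λ {x} {y} e (p , fixes) → P-resp {x} {y} e p , Fixes0-resp {x} {y} e fixes)

  ∁Fixes0-card : ∃[ N ] HasCardinality (Sub S (P ∩ ∁ Fixes0)) N × HasCardinality (Sub S (P′ ∩ ∁ Fixes0)) N
  ∁Fixes0-card = equinumerous-difference finite
    P? (λ x → exchange (statistics x) ≟ₛ w) fixes0?
    (λ {x} {y} → P-resp {x} {y}) (λ {x} {y} → P′-resp {x} {y}) (λ {x} {y} → Fixes0-resp {x} {y})
    all-equinumerous Fixes0-equinumerous

theorem1p2 : ∀ (n : ℕ) → 1 ≤ n →
    EquallyDistributed (S₃₂₁ n) {V = ℕ × ℕ × ℕ × ℕ × ℕ}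
    (λ (π , _) → rlm π , rlmin π , wm̄ π , des π , ides π)
    (λ (π , _) → rlm π , wm̄ π , rlmin π , des π , ides π)
theorem1p2 (suc n) _ (r , w) = fibres r
  where
  S : Setoid 0ℓ 0ℓ
  S = S₃₂₁ (suc n)

  open S₃₂₁ (suc n) using (Carrier)

  FibrePred : (Carrier → Statistics) → ℕ → Pred Carrier 0ℓ
  FibrePred h r x = (rlm (proj₁ x) , h x) ≡ (r , w)

  module _ (h : Carrier → Statistics) {N : ℕ} where

    Fibre-0 : HasCardinality (Sub S ((λ x → h x ≡ w) ∩ Fixes0)) N → HasCardinality (Sub S (FibrePred h 0)) N
    Fibre-0 = HasCardinality-resp {X = S} {P = (λ x → h x ≡ w) ∩ Fixes0} {Q = FibrePred h 0}
      (λ (π , _) (e , fixes) → cong₂ _,_ (rlm-fixed π fixes) e)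
      -- If π₁ were not 1, `rlm` would be 1 rather than 0; decidability of π₁ = 1 removes the double
      -- negation.
      (λ x@(π , av) e → cong proj₂ e , decidable-stable (fixes0? x) λ moves →
        contradiction (trans (sym (rlm-moved π av moves)) (cong proj₁ e)) λ ())

    Fibre-1 : HasCardinality (Sub S ((λ x → h x ≡ w) ∩ ∁ Fixes0)) N → HasCardinality (Sub S (FibrePred h 1)) N
    Fibre-1 = HasCardinality-resp {X = S} {P = (λ x → h x ≡ w) ∩ ∁ Fixes0} {Q = FibrePred h 1}
      (λ (π , av) (e , moves) → cong₂ _,_ (rlm-moved π av moves) e)
      (λ (π , _) e → cong proj₂ e , λ fixes →
        contradiction (trans (sym (rlm-fixed π fixes)) (cong proj₁ e)) λ ())

  Fibre-2+ : ∀ h r x → ¬ FibrePred h (suc (suc r)) x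
  Fibre-2+ h r x@(π , av) e with fixes0? x
  ... | yes fixes = contradiction (trans (sym (rlm-fixed π fixes)) (cong proj₁ e)) λ ()
  ... | no moves  = contradiction (trans (sym (rlm-moved π av moves)) (cong proj₁ e)) λ ()

  fibres : ∀ r → ∃[ N ] HasCardinality (Sub S (FibrePred statistics r)) N ×
                        HasCardinality (Sub S (FibrePred (exchange ∘ statistics) r)) N
  fibres 0 = let N , I , J = Fixes0-card w in N , Fibre-0 statistics I , Fibre-0 (exchange ∘ statistics) J
  fibres 1 = let N , I , J = ∁Fixes0-card w in N , Fibre-1 statistics I , Fibre-1 (exchange ∘ statistics) J
  -- Since `rlm` takes only the values 0 and 1, both fibres are empty.
  fibres (suc (suc r)) = 0 , HasCardinality-empty (Fibre-2+ statistics r) ,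
    HasCardinality-empty (Fibre-2+ (exchange ∘ statistics) r)
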